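{- Let $D$ be a strongly connected directed graph (multiple edges allowed) with a fixed cyclic ordering of the out-edges at each vertex. Then for every vertex $w$ of $D$, the number of rotor-router unicycle-orbits of $D$ equals $\frac{\mathcal{T}(D,w)}{{\rm per}_D(w)}$.
   Context: At each vertex $v$ a cyclic ordering of the outgoing edges is fixed; for an edge $e$ with tail $v$, $e^+$ is the next edge in this order. A rotor configuration $\varrho$ assigns to each vertex $v$ an out-edge $\varrho(v)$ with tail $v$. A chip-and-rotor configuration is a pair $(w,\varrho)$ with $w$ a vertex. The rotor-router operation sends $(w,\varrho)$ to $(w^+,\varrho^+)$ with $\varrho^+(v)=\varrho(v)$ for $v\ne w$, $\varrho^+(w)=\varrho(w)^+$, and $w^+$ the head of $\varrho^+(w)$. A unicycle is a chip-and-rotor configuration $(w,\varrho)$ such that $\{\varrho(v)\}$ contains a unique directed cycle and $w$ lies on it; for strongly connected $D$ the rotor-router operation permutes the unicycles, and unicycle-orbits are the orbits of this permutation. Identify $V$ with $\{1,\dots,n\}$; the Laplacian $L_D$ has $L_D(i,i)=-d^+(i)$ and $L_D(i,j)=d(j,i)$ (number of edges from $j$ to $i$) for $i\ne j$. ${\rm per}_D$ is the unique vector in $\mathbb{Z}^n$ with positive entries having no nontrivial common divisor such that $L_D\,{\rm per}_D=0$. $\mathcal{T}(D,w)$ is the number of spanning in-arborescences of $D$ rooted at $w$, i.e. spanning acyclic subdigraphs in which every vertex $v\ne w$ has a unique directed path to $w$ (every vertex other than $w$ has out-degree one, $w$ has out-degree zero). -}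

module Defs where

open import Data.Nat using (ℕ; zero; suc; _<_)
open import Data.Nat.Divisibility using (_∣_)
open import Data.Integer using (ℤ; +_; -_; _*_; _+_)
open import Data.Fin using (Fin; zero; suc; _≟_)
open import Data.Fin.Subset using (Subset; _∈_)
open import Data.Bool using (Bool; true; false; if_then_else_; _∧_)
open import Data.Vec using (Vec; lookup; _[_]≔_)
open import Data.List using (List; length)
import Data.List.Membership.Propositional as LM
open import Data.List.Relation.Unary.All using (All)
open import Data.List.Relation.Unary.Any using (Any)
open import Data.List.Relation.Unary.AllPairs using (AllPairs)
open import Data.List.Relation.Unary.Unique.Propositional using (Unique)
open import Data.Product using (Σ; ∃; _×_; _,_)
open import Relation.Binary.PropositionalEquality using (_≡_; _≢_)
open import Relation.Nullary using (¬_)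
open import Relation.Nullary.Decidable using (⌊_⌋)
open import Function.Bundles using (_⇔_)
open import Function.Definitions using (Injective)
import Data.Unit
import Data.Nat

iter : {A : Set} → (A → A) → ℕ → A → A
iter f zero x = x
iter f (suc k) x = f (iter f k x)

HasCard : {A : Set} → (A → Set) → ℕ → Set
HasCard {A} P k =
  Σ (List A) λ xs → length xs ≡ k × Unique xs × (∀ x → P x ⇔ x LM.∈ xs)

countF : ∀ {m} → (Fin m → Bool) → ℕ
countF {zero} p = 0
countF {suc m} p = (if p zero then 1 else 0) Data.Nat.+ countF (λ i → p (suc i))

sumℤ : ∀ {n} → (Fin n → ℤ) → ℤ
sumℤ {zero} f = + 0
sumℤ {suc n} f = f zero + sumℤ (λ i → f (suc i))

record RotorGraph (n m : ℕ) : Set where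
  field
    tail : Fin m → Fin n
    head : Fin m → Fin n
    next : Fin m → Fin m
open RotorGraph public

module _ {n m : ℕ} (D : RotorGraph n m) where

  -- next is a cyclic ordering of the out-edges at every vertex:
  -- a permutation of the edges preserving tails, acting transitively
  -- (hence as a single cycle) on the out-edges of each vertex.
  IsCyclicOrder : Set
  IsCyclicOrder =
    (∀ e → tail D (next D e) ≡ tail D e)
    × Injective _≡_ _≡_ (next D)
    × (∀ e e' → tail D e ≡ tail D e' → ∃ λ k → iter (next D) k e ≡ e')

  data Path (P : Fin m → Set) : Fin n → Fin n → Set where
    here : ∀ {v} → Path P v v
    step : ∀ {u v} (e : Fin m) → P e → tail D e ≡ u → Path P (head D e) v → Path P u v

  AllEdges : Fin m → Set
  AllEdges _ = Data.Unit.⊤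

  StronglyConnected : Set
  StronglyConnected = ∀ u v → Path AllEdges u v

  IsRotor : Vec (Fin m) n → Set
  IsRotor ρ = ∀ v → tail D (lookup ρ v) ≡ v

  Config : Set
  Config = Fin n × Vec (Fin m) n

  op : Config → Config
  op (w , ρ) = head D (next D (lookup ρ w)) , (ρ [ w ]≔ next D (lookup ρ w))

  -- the vertex set C carries a directed cycle of the subdigraph {ρ(v)}
  -- (whose edges are then ρ(v), v ∈ C)
  IsCycle : Vec (Fin m) n → Subset n → Set
  IsCycle ρ C =
    (∃ λ v → v ∈ C)
    × (∀ v → v ∈ C → head D (lookup ρ v) ∈ C)
    × (∀ u v → u ∈ C → v ∈ C → ∃ λ k → iter (λ x → head D (lookup ρ x)) k u ≡ v)

  Unicycle : Config → Set
  Unicycle (w , ρ) =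
    IsRotor ρ × Σ (Subset n) λ C →
      IsCycle ρ C × w ∈ C × (∀ C' → IsCycle ρ C' → C' ≡ C)

  SameOrbit : Config → Config → Set
  SameOrbit x y = ∃ λ k → iter op k x ≡ y

  NumOrbits : ℕ → Set
  NumOrbits k =
    Σ (List Config) λ reps →
      length reps ≡ k
      × All Unicycle reps
      × AllPairs (λ x y → ¬ SameOrbit x y) reps
      × (∀ u → Unicycle u → Any (λ r → SameOrbit r u) reps)

  d : Fin n → Fin n → ℕ
  d j i = countF (λ e → ⌊ tail D e ≟ j ⌋ ∧ ⌊ head D e ≟ i ⌋)

  outdeg : Fin n → ℕ
  outdeg i = countF (λ e → ⌊ tail D e ≟ i ⌋)

  Laplacian : Fin n → Fin n → ℤ
  Laplacian i j = if ⌊ i ≟ j ⌋ then - (+ outdeg i) else + d j i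

  IsPer : (Fin n → ℕ) → Set
  IsPer per =
    (∀ i → 0 < per i)
    × (∀ c → (∀ i → c ∣ per i) → c ≡ 1)
    × (∀ i → sumℤ (λ j → Laplacian i j * + per j) ≡ + 0)

  IsArb : Fin n → Subset m → Set
  IsArb w S =
    (∀ v → v ≢ w → HasCard (λ e → e ∈ S × tail D e ≡ v) 1)
    × (∀ e → e ∈ S → tail D e ≢ w)
    × ¬ (Σ (Fin m) λ e → e ∈ S × Path (λ e' → e' ∈ S) (head D e) (tail D e))

{-# OPTIONS --safe #-}
module Submission where

-- Allow each edge e to be used at most per (tail e) times. Counting arrivals and departures, a run
-- from a unicycle can only get blocked at its starting vertex, with all edges into that vertex used
-- to capacity. The initial rotors are the last edges to be used and all lead to that vertex, so every
-- edge is then used to capacity and the configuration has returned. An earlier return would give a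
-- smaller vector of full turns in the kernel of the Laplacian, contradicting the primitivity of per.
-- So every orbit uses a given edge e₁ out of w exactly per w times, while the unicycles about to use
-- e₁ correspond to the arborescences rooted at w by forgetting the rotor at w.

open import Defs
open import Algebra.Properties.CommutativeSemigroup using (interchange)
open import Data.Bool using (Bool; true; false; if_then_else_; _∧_)
open import Data.Empty using (⊥)
open import Data.Fin using (Fin; zero; suc; toℕ; _≟_)
open import Data.Fin.Properties using (pigeonhole)
open import Data.Fin.Subset using (Subset; _∈_; _⊆_)
open import Data.Fin.Subset.Properties using (⊆-antisym)
open import Data.Integer as ℤ using (ℤ; -_) renaming (+_ to ⁺_)
import Data.Integer.Properties as ℤ
open import Data.List using (List; []; _∷_; length; map; filter; applyDownFrom; concatMap)
open import Data.List.Properties using (length-++; length-map)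
open import Data.List.Membership.Propositional using (find; lose)
import Data.List.Membership.Propositional as LM
import Data.List.Membership.Propositional.Properties as LMP
open import Data.List.Membership.Propositional.Properties.WithK using (unique∧set⇒bag)
open import Data.List.Relation.Binary.BagAndSetEquality using (∼bag⇒↭)
open import Data.List.Relation.Binary.Disjoint.Propositional using (Disjoint)
open import Data.List.Relation.Binary.Permutation.Propositional.Properties using (↭-length)
open import Data.List.Relation.Unary.All as All using (All; []; _∷_)
import Data.List.Relation.Unary.All.Properties as All
open import Data.List.Relation.Unary.AllPairs using (AllPairs; []; _∷_)
open import Data.List.Relation.Unary.Any using (Any; here; there)
open import Data.List.Relation.Unary.Unique.Propositional using (Unique)
import Data.List.Relation.Unary.Unique.Propositional.Properties as Unique
open import Data.Nat using (ℕ; zero; suc; _+_; _*_; _∸_; _≤_; _<_; z≤n; s≤s; NonZero; ≢-nonZero; >-nonZero)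
open import Data.Nat.Coprimality using (coprime-/gcd; coprime-divisor)
open import Data.Nat.Divisibility using (divides)
open import Data.Nat.DivMod using (_/_; m/n*n≡m)
open import Data.Nat.GCD using (gcd; gcd[m,n]∣m; gcd[m,n]∣n; gcd[m,n]≢0)
open import Data.Nat.Properties hiding (_≟_)
open import Algebra.Properties.Semiring.Sum +-*-semiring
  using (sum; sum-cong-≗; ∑-distrib-+; ∑-comm; *-distribˡ-sum; *-distribʳ-sum; sum-replicate-zero)
open import Data.Nat.Solver using (module +-*-Solver)
open import Data.Product using (∃; ∃₂; _×_; _,_; proj₁; proj₂)
open import Data.Sum using (_⊎_; inj₁; inj₂)
open import Data.Vec using (Vec; lookup; tabulate)
open import Data.Vec.Properties
  using (tabulate∘lookup; tabulate-cong; lookup∘tabulate; lookup∘update; lookup∘update′; []=⇒lookup; lookup⇒[]=)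
open import Function using (_∘_)
open import Function.Bundles using (_⇔_; mk⇔; Equivalence)
open import Function.Definitions using (Injective)
open import Relation.Binary.PropositionalEquality
  using (_≡_; _≢_; refl; sym; trans; cong; cong₂; subst; module ≡-Reasoning)
open import Relation.Nullary using (¬_; Dec; does; yes; no; contradiction)
open import Relation.Nullary.Decidable using (⌊_⌋; dec-true; ¬?; _×-dec_)

-- Kronecker deltas, finite sums and least ratios.

δ : ∀ {n} → Fin n → Fin n → ℕ
δ i j = if ⌊ i ≟ j ⌋ then 1 else 0

δ-refl : ∀ {n} (i : Fin n) → δ i i ≡ 1
δ-refl i with i ≟ i
... | yes _ = refl
... | no i≢i = contradiction refl i≢i

δ-≢ : ∀ {n} {i j : Fin n} → i ≢ j → δ i j ≡ 0
δ-≢ {i = i} {j} i≢j with i ≟ j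
... | yes i≡j = contradiction i≡j i≢j
... | no _ = refl

δ-suc : ∀ {n} (i j : Fin n) → δ (suc i) (suc j) ≡ δ i j
δ-suc i j with i ≟ j
... | yes refl = refl
... | no _ = refl

1≤δ⇒≡ : ∀ {n} {i j : Fin n} → 1 ≤ δ i j → i ≡ j
1≤δ⇒≡ {i = i} {j} _ with i ≟ j
... | yes i≡j = i≡j

sum-mono : ∀ {n} {f g : Fin n → ℕ} → (∀ i → f i ≤ g i) → sum f ≤ sum g
sum-mono {zero} f≤g = z≤n
sum-mono {suc n} f≤g = +-mono-≤ (f≤g zero) (sum-mono (f≤g ∘ suc))

term≤sum : ∀ {n} (f : Fin n → ℕ) i → f i ≤ sum f
term≤sum f zero = m≤m+n _ _
term≤sum f (suc i) = ≤-trans (term≤sum (f ∘ suc) i) (m≤n+m _ _)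

-- When the larger sum does not exceed the smaller one, no term has any slack left.
sum-mono-≡ : ∀ {n} {f g : Fin n → ℕ} → (∀ i → f i ≤ g i) → sum g ≤ sum f → ∀ i → f i ≡ g i
sum-mono-≡ {suc n} {f} {g} f≤g Σg≤Σf i = ≤-antisym (f≤g i) (g≤f i)
  where
  head-≤ : g zero ≤ f zero
  head-≤ = +-cancelʳ-≤ (sum (f ∘ suc)) _ _
    (≤-trans (+-monoʳ-≤ (g zero) (sum-mono (f≤g ∘ suc))) Σg≤Σf)
  tail-≤ : sum (g ∘ suc) ≤ sum (f ∘ suc)
  tail-≤ = +-cancelˡ-≤ (f zero) _ _
    (≤-trans (+-monoˡ-≤ _ (f≤g zero)) Σg≤Σf)
  g≤f : ∀ i → g i ≤ f i
  g≤f zero = head-≤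
  g≤f (suc i) = ≤-reflexive (sym (sum-mono-≡ (f≤g ∘ suc) tail-≤ i))

sum-zero : ∀ {n} {f : Fin n → ℕ} → (∀ i → f i ≡ 0) → sum f ≡ 0
sum-zero {n} f≡0 = trans (sum-cong-≗ f≡0) (sum-replicate-zero n)

sum-δ : ∀ {n} (a : Fin n) (h : Fin n → ℕ) → sum (λ i → δ a i * h i) ≡ h a
sum-δ {suc n} zero h = begin
  h zero + 0 + sum {n} (λ i → 0) ≡⟨ cong₂ _+_ (+-identityʳ (h zero)) (sum-zero {n} λ _ → refl) ⟩
  h zero + 0                     ≡⟨ +-identityʳ (h zero) ⟩
  h zero                         ∎
  where open ≡-Reasoning
sum-δ {suc n} (suc a) h =
  trans (sum-cong-≗ (λ i → cong (_* h (suc i)) (δ-suc a i))) (sum-δ a (h ∘ suc))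

sum-δ-1 : ∀ {n} (a : Fin n) → sum (δ a) ≡ 1
sum-δ-1 a = trans (sum-cong-≗ (λ i → sym (*-identityʳ (δ a i)))) (sum-δ a (λ _ → 1))

countF≡sum : ∀ {n} (p : Fin n → Bool) → countF p ≡ sum (λ i → if p i then 1 else 0)
countF≡sum {zero} p = refl
countF≡sum {suc n} p = cong ((if p zero then 1 else 0) +_) (countF≡sum (p ∘ suc))

if-∧ : ∀ a b → (if a ∧ b then 1 else 0) ≡ (if a then 1 else 0) * (if b then 1 else 0)
if-∧ false b = refl
if-∧ true false = refl
if-∧ true true = refl

-- The summand `a` compensates the negative entries of `f`, so a row of the Laplacian turns into an
-- equation between natural sums.
sumℤ-+ : ∀ {n} (f : Fin n → ℤ) (a b : Fin n → ℕ) → (∀ i → f i ℤ.+ ⁺ a i ≡ ⁺ b i) →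
         sumℤ f ℤ.+ ⁺ sum a ≡ ⁺ sum b
sumℤ-+ {zero} f a b eq = refl
sumℤ-+ {suc n} f a b eq = begin
  (f zero ℤ.+ F) ℤ.+ (⁺ a zero ℤ.+ ⁺ A) ≡⟨ interchange ℤ.+-commutativeSemigroup (f zero) F (⁺ a zero) (⁺ A) ⟩
  (f zero ℤ.+ ⁺ a zero) ℤ.+ (F ℤ.+ ⁺ A) ≡⟨ cong₂ ℤ._+_ (eq zero) (sumℤ-+ (f ∘ suc) (a ∘ suc) (b ∘ suc) (eq ∘ suc)) ⟩
  ⁺ b zero ℤ.+ ⁺ sum (b ∘ suc)          ∎
  where
  open ≡-Reasoning
  F = sumℤ (f ∘ suc)
  A = sum (a ∘ suc)

-- The index minimizes `a i / b i`; cross-multiplication avoids fractions. The argument of type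
-- `Fin n` witnesses that there is an index at all.
least-ratio : ∀ {n} → Fin n → (a b : Fin n → ℕ) → (∀ i → 0 < b i) →
              ∃ λ i → ∀ j → a i * b j ≤ a j * b i
least-ratio {suc zero} _ a b b>0 = zero , λ { zero → ≤-refl }
least-ratio {suc (suc n)} _ a b b>0
  with i , least ← least-ratio zero (a ∘ suc) (b ∘ suc) (b>0 ∘ suc)
  with ≤-total (a zero * b (suc i)) (a (suc i) * b zero)
... | inj₂ ge = suc i , λ { zero → ge ; (suc j) → least j }
... | inj₁ le = zero , λ { zero → ≤-refl ; (suc j) → zero-least j }
  where
  instance
    bᵢ≢0 : NonZero (b (suc i))
    bᵢ≢0 = >-nonZero (b>0 (suc i))
  open ≤-Reasoning
  open +-*-Solver
  swap-right : ∀ x y z → x * y * z ≡ x * z * y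
  swap-right = solve 3 (λ x y z → x :* y :* z := x :* z :* y) refl
  zero-least : ∀ j → a zero * b (suc j) ≤ a (suc j) * b zero
  zero-least j = *-cancelʳ-≤ _ _ (b (suc i)) (begin
    a zero * b (suc j) * b (suc i)    ≡⟨ swap-right (a zero) _ _ ⟩
    a zero * b (suc i) * b (suc j)    ≤⟨ *-monoˡ-≤ (b (suc j)) le ⟩
    a (suc i) * b zero * b (suc j)    ≡⟨ swap-right (a (suc i)) _ _ ⟩
    a (suc i) * b (suc j) * b zero    ≤⟨ *-monoˡ-≤ (b zero) (least j) ⟩
    a (suc j) * b (suc i) * b zero    ≡⟨ swap-right (a (suc j)) _ _ ⟩
    a (suc j) * b zero * b (suc i)    ∎)

-- Edge flows, the kernel of the Laplacian and the minimality of `per`.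

module _ {n m : ℕ} (D : RotorGraph n m) where

  flux : (Fin m → Fin n) → (Fin m → ℕ) → Fin n → ℕ
  flux end f i = sum λ e → δ (end e) i * f e

  In Out : (Fin m → ℕ) → Fin n → ℕ
  In = flux (head D)
  Out = flux (tail D)

  -- `c ∘ tail D` is the edge usage of `c v` full rotor turns at each `v`; Kirchhoff's law for this
  -- flow expresses the Laplacian kernel without negative numbers.
  Balanced : (Fin n → ℕ) → Set
  Balanced c = ∀ i → In (c ∘ tail D) i ≡ Out (c ∘ tail D) i

  Out-tail : ∀ c i → Out (c ∘ tail D) i ≡ outdeg D i * c i
  Out-tail c i = begin
    sum (λ e → δ (tail D e) i * c (tail D e)) ≡⟨ sum-cong-≗ at-i ⟩
    sum (λ e → δ (tail D e) i * c i)          ≡⟨ *-distribʳ-sum (c i) (λ e → δ (tail D e) i) ⟨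
    sum (λ e → δ (tail D e) i) * c i          ≡⟨ cong (_* c i) (countF≡sum (λ e → ⌊ tail D e ≟ i ⌋)) ⟨
    outdeg D i * c i                          ∎
    where
    open ≡-Reasoning
    at-i : ∀ e → δ (tail D e) i * c (tail D e) ≡ δ (tail D e) i * c i
    at-i e with tail D e ≟ i
    ... | yes refl = refl
    ... | no _ = refl

  In-tail : ∀ c i → In (c ∘ tail D) i ≡ sum (λ j → d D j i * c j)
  In-tail c i = sym (begin
    sum (λ j → d D j i * c j)
      ≡⟨ sum-cong-≗ expand ⟩
    sum (λ j → sum λ e → δ (tail D e) j * (δ (head D e) i * c j))
      ≡⟨ ∑-comm (λ j e → δ (tail D e) j * (δ (head D e) i * c j)) ⟩
    sum (λ e → sum λ j → δ (tail D e) j * (δ (head D e) i * c j))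
      ≡⟨ sum-cong-≗ (λ e → sum-δ (tail D e) (λ j → δ (head D e) i * c j)) ⟩
    In (c ∘ tail D) i ∎)
    where
    open ≡-Reasoning
    expand : ∀ j → d D j i * c j ≡ sum λ e → δ (tail D e) j * (δ (head D e) i * c j)
    expand j = begin
      d D j i * c j
        ≡⟨ cong (_* c j) (trans (countF≡sum (λ e → ⌊ tail D e ≟ j ⌋ ∧ ⌊ head D e ≟ i ⌋))
          (sum-cong-≗ (λ e → if-∧ ⌊ tail D e ≟ j ⌋ ⌊ head D e ≟ i ⌋))) ⟩
      sum (λ e → δ (tail D e) j * δ (head D e) i) * c j
        ≡⟨ *-distribʳ-sum (c j) (λ e → δ (tail D e) j * δ (head D e) i) ⟩
      sum (λ e → δ (tail D e) j * δ (head D e) i * c j)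
        ≡⟨ sum-cong-≗ (λ e → *-assoc (δ (tail D e) j) (δ (head D e) i) (c j)) ⟩
      sum (λ e → δ (tail D e) j * (δ (head D e) i * c j)) ∎

  sum-flux : ∀ end f → sum (flux end f) ≡ sum f
  sum-flux end f = trans (∑-comm (λ i e → δ (end e) i * f e)) (sum-cong-≗ (λ e → sum-δ (end e) (λ _ → f e)))

  -- Loops count in the diagonal but cancel nowhere, so a kernel vector is balanced up to a
  -- nonnegative loop term; summing over all vertices shows that this term vanishes.
  kernel⇒balanced : ∀ c → (∀ i → sumℤ (λ j → Laplacian D i j ℤ.* ⁺ c j) ≡ ⁺ 0) → Balanced c
  kernel⇒balanced c Lc≡0 i = trans (In≡Out+loops i) (trans (cong (Out (c ∘ tail D) i +_) (no-loops i)) (+-identityʳ _))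
    where
    open ≡-Reasoning
    loops : Fin n → ℕ
    loops i = d D i i * c i
    off : Fin n → Fin n → ℕ
    off i j = if ⌊ i ≟ j ⌋ then 0 else d D j i * c j
    entry : ∀ i j → Laplacian D i j ℤ.* ⁺ c j ℤ.+ ⁺ (δ i j * (outdeg D j * c j)) ≡ ⁺ off i j
    entry i j with i ≟ j
    ... | yes refl = begin
      - (⁺ outdeg D i) ℤ.* ⁺ c i ℤ.+ ⁺ (outdeg D i * c i + 0)
        ≡⟨ cong₂ ℤ._+_ (sym (ℤ.neg-distribˡ-* (⁺ outdeg D i) (⁺ c i)))
             (trans (cong ⁺_ (+-identityʳ _)) (ℤ.pos-* (outdeg D i) (c i))) ⟩
      - (⁺ outdeg D i ℤ.* ⁺ c i) ℤ.+ ⁺ outdeg D i ℤ.* ⁺ c i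
        ≡⟨ ℤ.+-inverseˡ (⁺ outdeg D i ℤ.* ⁺ c i) ⟩
      ⁺ 0 ∎
    ... | no _ = trans (ℤ.+-identityʳ _) (sym (ℤ.pos-* (d D j i) (c j)))
    split : ∀ i j → off i j + δ i j * loops j ≡ d D j i * c j
    split i j with i ≟ j
    ... | yes refl = +-identityʳ _
    ... | no _ = +-identityʳ _
    In≡Out+loops : ∀ i → In (c ∘ tail D) i ≡ Out (c ∘ tail D) i + loops i
    In≡Out+loops i = begin
      In (c ∘ tail D) i                                 ≡⟨ In-tail c i ⟩
      sum (λ j → d D j i * c j)                         ≡⟨ sum-cong-≗ (split i) ⟨
      sum (λ j → off i j + δ i j * loops j)             ≡⟨ ∑-distrib-+ (off i) (λ j → δ i j * loops j) ⟩
      sum (off i) + sum (λ j → δ i j * loops j)         ≡⟨ cong₂ _+_ (sym diag≡off) (sum-δ i loops) ⟩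
      sum (λ j → δ i j * (outdeg D j * c j)) + loops i  ≡⟨ cong (_+ loops i) (sum-δ i (λ j → outdeg D j * c j)) ⟩
      outdeg D i * c i + loops i                        ≡⟨ cong (_+ loops i) (Out-tail c i) ⟨
      Out (c ∘ tail D) i + loops i                      ∎
      where
      diag : Fin n → ℕ
      diag j = δ i j * (outdeg D j * c j)
      diag≡off : sum diag ≡ sum (off i)
      diag≡off = ℤ.+-injective (begin
        ⁺ sum diag                                               ≡⟨ ℤ.+-identityˡ _ ⟨
        ⁺ 0 ℤ.+ ⁺ sum diag                                       ≡⟨ cong (ℤ._+ ⁺ sum diag) (Lc≡0 i) ⟨
        sumℤ (λ j → Laplacian D i j ℤ.* ⁺ c j) ℤ.+ ⁺ sum diag    ≡⟨ sumℤ-+ _ diag (off i) (entry i) ⟩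
        ⁺ sum (off i)                                            ∎)
    sum-loops : sum loops ≡ 0
    sum-loops = +-cancelˡ-≡ (sum (c ∘ tail D)) _ _ (begin
      sum (c ∘ tail D) + sum loops           ≡⟨ cong (_+ sum loops) (sum-flux (tail D) (c ∘ tail D)) ⟨
      sum (Out (c ∘ tail D)) + sum loops     ≡⟨ ∑-distrib-+ (Out (c ∘ tail D)) loops ⟨
      sum (λ i → Out (c ∘ tail D) i + loops i) ≡⟨ sum-cong-≗ In≡Out+loops ⟨
      sum (In (c ∘ tail D))                  ≡⟨ sum-flux (head D) (c ∘ tail D) ⟩
      sum (c ∘ tail D)                       ≡⟨ +-identityʳ _ ⟨
      sum (c ∘ tail D) + 0                   ∎)
    no-loops : ∀ i → loops i ≡ 0
    no-loops i = n≤0⇒n≡0 (subst (loops i ≤_) sum-loops (term≤sum loops i))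

  -- The two in-fluxes at `i` coincide, so they agree term by term, and the factor `δ` is 1 on the
  -- edges into `i`.
  In-mono-≡ : ∀ {f g : Fin m → ℕ} {i} → (∀ e → f e ≤ g e) → In g i ≤ In f i → ∀ e → head D e ≡ i → f e ≡ g e
  In-mono-≡ {f} {g} f≤g Ig≤If e refl = trans (sym (drop-δ f)) (trans
    (sum-mono-≡ (λ e′ → *-monoʳ-≤ (δ (head D e′) (head D e)) (f≤g e′)) Ig≤If e) (drop-δ g))
    where
    drop-δ : ∀ h → δ (head D e) (head D e) * h e ≡ h e
    drop-δ h = trans (cong (_* h e) (δ-refl (head D e))) (*-identityˡ (h e))

  Balanced-scale : ∀ {c} q → Balanced c → Balanced (λ j → q * c j)
  Balanced-scale {c} q bal i = begin
    In (λ e → q * c (tail D e)) i    ≡⟨ pull (head D) ⟩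
    q * In (c ∘ tail D) i            ≡⟨ cong (q *_) (bal i) ⟩
    q * Out (c ∘ tail D) i           ≡⟨ pull (tail D) ⟨
    Out (λ e → q * c (tail D e)) i   ∎
    where
    open ≡-Reasoning
    open +-*-Solver
    pull : ∀ end → flux end (λ e → q * c (tail D e)) i ≡ q * flux end (c ∘ tail D) i
    pull end = trans
      (sum-cong-≗ λ e → solve 3 (λ x y z → x :* (y :* z) := y :* (x :* z)) refl (δ (end e) i) q (c (tail D e)))
      (sym (*-distribˡ-sum q (λ e → δ (end e) i * c (tail D e))))

  -- Equality spreads backwards along edges: equal values at the head of `e` give equal out-fluxes
  -- there, by balance equal in-fluxes, and then `a ≤ b` leaves no slack on `e`, so the values at
  -- its tail agree.
  balanced-touching : ∀ {a b u v} → Balanced a → Balanced b → (∀ j → a j ≤ b j) →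
                      Path D (AllEdges D) u v → a v ≡ b v → a u ≡ b u
  balanced-touching bal-a bal-b a≤b here eq = eq
  balanced-touching {a} {b} bal-a bal-b a≤b (step e _ refl path) eq =
    In-mono-≡ {a ∘ tail D} {b ∘ tail D} (a≤b ∘ tail D) (≤-reflexive In-eq) e refl
    where
    i = head D e
    In-eq : In (b ∘ tail D) i ≡ In (a ∘ tail D) i
    In-eq = begin
      In (b ∘ tail D) i   ≡⟨ bal-b i ⟩
      Out (b ∘ tail D) i  ≡⟨ Out-tail b i ⟩
      outdeg D i * b i    ≡⟨ cong (outdeg D i *_) (balanced-touching bal-a bal-b a≤b path eq) ⟨
      outdeg D i * a i    ≡⟨ Out-tail a i ⟨
      Out (a ∘ tail D) i  ≡⟨ bal-a i ⟨
      In (a ∘ tail D) i   ∎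
      where open ≡-Reasoning

  -- Scale per by the least ratio c i / per i: the scaled vectors touch at i, hence coincide,
  -- so c is a multiple of the primitive vector per.
  per-minimal : StronglyConnected D → ∀ {per c} → IsPer D per → Balanced c →
                ∀ v → 0 < c v → ∀ j → per j ≤ c j
  per-minimal sc {per} {c} (per>0 , coprime-per , Lper≡0) bal v c>0 j
    with i , least ← least-ratio v c per per>0
    = goal q multiple
    where
    proportional : ∀ j → c i * per j ≡ per i * c j
    proportional j = balanced-touching
      (Balanced-scale {per} (c i) (kernel⇒balanced per Lper≡0)) (Balanced-scale {c} (per i) bal)
      (λ j → ≤-trans (least j) (≤-reflexive (*-comm (c j) (per i)))) (sc j i) (*-comm (c i) (per i))
    g = gcd (per i) (c i)
    instance
      g≢0 : NonZero g
      g≢0 = ≢-nonZero (gcd[m,n]≢0 (per i) (c i) (inj₁ (>⇒≢ (per>0 i))))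
    p q : ℕ
    p = per i / g
    q = c i / g
    reduced : ∀ j → p * c j ≡ q * per j
    reduced j = *-cancelʳ-≡ _ _ g (begin
      p * c j * g    ≡⟨ swap p (c j) g ⟩
      p * g * c j    ≡⟨ cong (_* c j) (m/n*n≡m (gcd[m,n]∣m (per i) (c i))) ⟩
      per i * c j    ≡⟨ proportional j ⟨
      c i * per j    ≡⟨ cong (_* per j) (m/n*n≡m (gcd[m,n]∣n (per i) (c i))) ⟨
      q * g * per j  ≡⟨ swap q g (per j) ⟩
      q * per j * g  ∎)
      where
      open ≡-Reasoning
      open +-*-Solver
      swap : ∀ x y z → x * y * z ≡ x * z * y
      swap = solve 3 (λ x y z → x :* y :* z := x :* z :* y) refl
    -- `p` divides `q * per j` and is coprime to `q`, so it is a common divisor of all entries of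
    -- `per`.
    p≡1 : p ≡ 1
    p≡1 = coprime-per p λ j → coprime-divisor (coprime-/gcd (per i) (c i))
      (divides (c j) (trans (sym (reduced j)) (*-comm p (c j))))
    multiple : ∀ j → c j ≡ q * per j
    multiple j = trans (sym (*-identityˡ (c j))) (trans (cong (_* c j) (sym p≡1)) (reduced j))
    -- Abstracting `q` allows splitting it; `q = 0` would make `c v` vanish.
    goal : ∀ q → (∀ j → c j ≡ q * per j) → per j ≤ c j
    goal zero eq = contradiction (eq v) (>⇒≢ c>0)
    goal (suc q) eq = ≤-trans (m≤m+n (per j) (q * per j)) (≤-reflexive (sym (eq j)))

-- Iteration, decidable subsets and duplicate-free lists.

iter-+ : ∀ {A : Set} (f : A → A) j k x → iter f (j + k) x ≡ iter f j (iter f k x)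
iter-+ f zero k x = refl
iter-+ f (suc j) k x = cong f (iter-+ f j k x)

iter-shift : ∀ {A : Set} (f : A → A) k x → iter f (suc k) x ≡ iter f k (f x)
iter-shift f zero x = refl
iter-shift f (suc k) x = cong f (iter-shift f k x)

lookup-injective : ∀ {A : Set} {n} {xs ys : Vec A n} → (∀ i → lookup xs i ≡ lookup ys i) → xs ≡ ys
lookup-injective {xs = xs} {ys} eq =
  trans (sym (tabulate∘lookup xs)) (trans (tabulate-cong eq) (tabulate∘lookup ys))

subset : ∀ {k} {P : Fin k → Set} → (∀ i → Dec (P i)) → Subset k
subset P? = tabulate (λ i → does (P? i))

∈-subset⁺ : ∀ {k} {P : Fin k → Set} (P? : ∀ i → Dec (P i)) {i} → P i → i ∈ subset P?
∈-subset⁺ P? {i} Pi = lookup⇒[]= i _ (trans (lookup∘tabulate _ i) (dec-true (P? i) Pi))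

∈-subset⁻ : ∀ {k} {P : Fin k → Set} (P? : ∀ i → Dec (P i)) {i} → i ∈ subset P? → P i
∈-subset⁻ P? {i} i∈ with P? i | trans (sym (lookup∘tabulate (λ i → does (P? i)) i)) ([]=⇒lookup i∈)
... | yes Pi | _ = Pi
... | no _ | ()

-- Two of the first `k + 1` iterates coincide by the pigeonhole principle; writing the period as
-- `suc p` keeps it positive.
eventually-periodic : ∀ {k} (g : Fin k → Fin k) u → ∃₂ λ i p → iter g (suc p) (iter g i u) ≡ iter g i u
eventually-periodic {k} g u with a , b , a<b , same ← pigeonhole (n<1+n k) (λ a → iter g (toℕ a) u)
  = i , p , (begin
    iter g (suc p) (iter g i u)   ≡⟨ iter-+ g (suc p) i u ⟨
    iter g (suc p + i) u          ≡⟨ cong (λ l → iter g l u) (trans (sym (+-suc p i)) (m∸n+n≡m a<b)) ⟩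
    iter g (toℕ b) u              ≡⟨ same ⟨
    iter g i u                    ∎)
  where
  open ≡-Reasoning
  i = toℕ a
  p = toℕ b ∸ suc i

-- Reduces the exponent modulo `p` by counting up and wrapping from `p - 1` to 0.
iter-mod : ∀ {A : Set} (g : A → A) {y p} → 0 < p → iter g p y ≡ y → ∀ k → ∃ λ j → j < p × iter g j y ≡ iter g k y
iter-mod g p>0 return zero = 0 , p>0 , refl
iter-mod g {y} {p} p>0 return (suc k) with j , j<p , eq ← iter-mod g p>0 return k with m≤n⇒m<n∨m≡n j<p
... | inj₁ 1+j<p = suc j , 1+j<p , cong g eq
... | inj₂ refl = 0 , p>0 , trans (sym return) (cong g eq)

-- Injectivity is asked only on members of the list, because `tree` will be shown injective on
-- marked configurations.
map-unique : ∀ {A B : Set} (f : A → B) {xs} →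
  (∀ {x y} → x LM.∈ xs → y LM.∈ xs → f x ≡ f y → x ≡ y) → Unique xs → Unique (map f xs)
map-unique f inj [] = []
map-unique f inj (x∉xs ∷ unique) =
  All.map⁺ (All.tabulate (λ y∈ eq → All.lookup x∉xs y∈ (inj (here refl) (there y∈) eq))) ∷
  map-unique f (λ x∈ y∈ → inj (there x∈) (there y∈)) unique

-- Without duplicates, equality as sets is equality as bags, hence a permutation.
unique-length : ∀ {A : Set} {xs ys : List A} → Unique xs → Unique ys →
  (∀ {z} → z LM.∈ xs ⇔ z LM.∈ ys) → length xs ≡ length ys
unique-length ux uy same = ↭-length (∼bag⇒↭ (unique∧set⇒bag ux uy same))

-- Conservation laws along a run of the rotor-router.

module Rotor {n m : ℕ} (D : RotorGraph n m) (cyclic : IsCyclicOrder D) where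

  tail-next : ∀ e → tail D (next D e) ≡ tail D e
  tail-next = proj₁ cyclic

  next-injective : Injective _≡_ _≡_ (next D)
  next-injective = proj₁ (proj₂ cyclic)

  next-transitive : ∀ e e′ → tail D e ≡ tail D e′ → ∃ λ k → iter (next D) k e ≡ e′
  next-transitive = proj₂ (proj₂ cyclic)

  tail-iter-next : ∀ k e → tail D (iter (next D) k e) ≡ tail D e
  tail-iter-next zero e = refl
  tail-iter-next (suc k) e = trans (tail-next _) (tail-iter-next k e)

  chip : Config D → Fin n
  chip = proj₁

  rotor : Config D → Fin n → Fin m
  rotor x = lookup (proj₂ x)

  -- The rotor advances before the chip moves, so the edge traversed next is the successor of the
  -- current rotor.
  departing : Config D → Fin m
  departing x = next D (rotor x (chip x))

  run : ℕ → Config D → Config D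
  run = iter (op D)

  Valid : Config D → Set
  Valid x = IsRotor D (proj₂ x)

  tail-departing : ∀ {x} → Valid x → tail D (departing x) ≡ chip x
  tail-departing valid = trans (tail-next _) (valid _)

  rotor-op-chip : ∀ x → rotor (op D x) (chip x) ≡ departing x
  rotor-op-chip (w , ρ) = lookup∘update w ρ _

  rotor-op-≢ : ∀ x {v} → v ≢ chip x → rotor (op D x) v ≡ rotor x v
  rotor-op-≢ (w , ρ) v≢w = lookup∘update′ v≢w ρ _

  op-valid : ∀ {x} → Valid x → Valid (op D x)
  op-valid {x} valid v with v ≟ chip x
  ... | yes refl = trans (cong (tail D) (rotor-op-chip x)) (tail-departing {x} valid)
  ... | no v≢w = trans (cong (tail D) (rotor-op-≢ x v≢w)) (valid v)

  run-valid : ∀ {x} → Valid x → ∀ T → Valid (run T x)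
  run-valid valid zero = valid
  run-valid {x} valid (suc T) = op-valid {run T x} (run-valid {x} valid T)

  uses : Config D → ℕ → Fin m → ℕ
  uses x zero e = 0
  uses x (suc T) e = δ (departing (run T x)) e + uses x T e

  uses-mono : ∀ x {S T} → S ≤ T → ∀ e → uses x S e ≤ uses x T e
  uses-mono x {T = zero} z≤n e = z≤n
  uses-mono x {S} {suc T} S≤1+T e with m≤n⇒m<n∨m≡n S≤1+T
  ... | inj₁ S<1+T = ≤-trans (uses-mono x (≤-pred S<1+T) e) (m≤n+m _ _)
  ... | inj₂ refl = ≤-refl

  uses-+ : ∀ x p i e → uses x (p + i) e ≡ uses (run i x) p e + uses x i e
  uses-+ x zero i e = refl
  uses-+ x (suc p) i e = trans
    (cong₂ _+_ (cong (λ y → δ (departing y) e) (iter-+ (op D) p i x)) (uses-+ x p i e))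
    (sym (+-assoc (δ (departing (run p (run i x))) e) _ _))

  sum-uses : ∀ x T → sum (uses x T) ≡ T
  sum-uses x zero = sum-zero {m} (λ _ → refl)
  sum-uses x (suc T) = trans (∑-distrib-+ (δ (departing (run T x))) (uses x T))
    (cong₂ _+_ (sum-δ-1 (departing (run T x))) (sum-uses x T))

  flux-δ : ∀ end a u i → flux D end (λ e → δ a e + u e) i ≡ δ (end a) i + flux D end u i
  flux-δ end a u i = begin
    sum (λ e → δ (end e) i * (δ a e + u e))
      ≡⟨ sum-cong-≗ (λ e → trans (*-distribˡ-+ (δ (end e) i) (δ a e) (u e))
           (cong (_+ δ (end e) i * u e) (*-comm (δ (end e) i) (δ a e)))) ⟩
    sum (λ e → δ a e * δ (end e) i + δ (end e) i * u e)
      ≡⟨ ∑-distrib-+ (λ e → δ a e * δ (end e) i) (λ e → δ (end e) i * u e) ⟩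
    sum (λ e → δ a e * δ (end e) i) + flux D end u i
      ≡⟨ cong (_+ flux D end u i) (sum-δ a (λ e → δ (end e) i)) ⟩
    δ (end a) i + flux D end u i ∎
    where open ≡-Reasoning

  -- Arrivals minus departures at `i` telescope along the path of the chip; the two endpoint terms
  -- stand on opposite sides to avoid subtraction.
  chip-conservation : ∀ {x} → Valid x → ∀ T i →
    In D (uses x T) i + δ (chip x) i ≡ Out D (uses x T) i + δ (chip (run T x)) i
  chip-conservation {x} valid zero i =
    cong (_+ δ (chip x) i) (trans (zero-flux (head D)) (sym (zero-flux (tail D))))
    where
    zero-flux : ∀ end → flux D end (λ _ → 0) i ≡ 0
    zero-flux end = sum-zero (λ e → *-zeroʳ (δ (end e) i))
  chip-conservation {x} valid (suc T) i = begin
    In D (uses x (suc T)) i + δ (chip x) i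
      ≡⟨ cong (_+ δ (chip x) i) (flux-δ (head D) a (uses x T) i) ⟩
    δ (head D a) i + In D (uses x T) i + δ (chip x) i
      ≡⟨ +-assoc (δ (head D a) i) _ _ ⟩
    δ (head D a) i + (In D (uses x T) i + δ (chip x) i)
      ≡⟨ cong (δ (head D a) i +_) (chip-conservation {x} valid T i) ⟩
    δ (head D a) i + (Out D (uses x T) i + δ (chip y) i)
      ≡⟨ cong (λ v → δ (head D a) i + (Out D (uses x T) i + δ v i)) (tail-departing {y} (run-valid {x} valid T)) ⟨
    δ (head D a) i + (Out D (uses x T) i + δ (tail D a) i)
      ≡⟨ solve 3 (λ h o t → h :+ (o :+ t) := t :+ o :+ h) refl (δ (head D a) i) (Out D (uses x T) i) (δ (tail D a) i) ⟩
    δ (tail D a) i + Out D (uses x T) i + δ (head D a) i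
      ≡⟨ cong (_+ δ (head D a) i) (flux-δ (tail D) a (uses x T) i) ⟨
    Out D (uses x (suc T)) i + δ (head D a) i ∎
    where
    open ≡-Reasoning
    open +-*-Solver using (solve; _:=_; _:+_)
    y = run T x
    a = departing y

  δ-next : ∀ e e′ → δ (next D e) (next D e′) ≡ δ e e′
  δ-next e e′ with e ≟ e′
  ... | yes refl = δ-refl (next D e)
  ... | no e≢e′ = δ-≢ (λ eq → e≢e′ (next-injective eq))

  -- At the vertex of the chip, the old rotor is `e` exactly when `next D e` departs, and the new
  -- rotor is `e` exactly when `e` departs. At other vertices nothing changes.
  rotor-step : ∀ {x} → Valid x → ∀ e →
    δ (departing x) e + δ (rotor x (tail D e)) e ≡ δ (departing x) (next D e) + δ (rotor (op D x) (tail D e)) e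
  rotor-step {x} valid e with tail D e ≟ chip x
  ... | yes refl = begin
    δ (departing x) e + δ (rotor x (chip x)) e
      ≡⟨ +-comm (δ (departing x) e) _ ⟩
    δ (rotor x (chip x)) e + δ (departing x) e
      ≡⟨ cong₂ (λ k b → k + δ b e) (δ-next (rotor x (chip x)) e) (rotor-op-chip x) ⟨
    δ (departing x) (next D e) + δ (rotor (op D x) (chip x)) e ∎
    where open ≡-Reasoning
  ... | no v≢w = begin
    δ (departing x) e + δ (rotor x (tail D e)) e
      ≡⟨ cong (_+ δ (rotor x (tail D e)) e) (trans (δ-≢ (other refl)) (sym (δ-≢ (other (tail-next e))))) ⟩
    δ (departing x) (next D e) + δ (rotor x (tail D e)) e
      ≡⟨ cong (λ b → δ (departing x) (next D e) + δ b e) (rotor-op-≢ x v≢w) ⟨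
    δ (departing x) (next D e) + δ (rotor (op D x) (tail D e)) e ∎
    where
    open ≡-Reasoning
    other : ∀ {e′} → tail D e′ ≡ tail D e → departing x ≢ e′
    other same refl = v≢w (trans (sym same) (tail-departing {x} valid))

  -- Every traversal of e is followed by one of next e, except for the last one if the rotor still
  -- points at e, and the first use of next e needs no predecessor if the rotor started at e.
  rotor-conservation : ∀ {x} → Valid x → ∀ T e →
    uses x T e + δ (rotor x (tail D e)) e ≡ uses x T (next D e) + δ (rotor (run T x) (tail D e)) e
  rotor-conservation valid zero e = refl
  rotor-conservation {x} valid (suc T) e = begin
    δ a e + u e + start           ≡⟨ +-assoc (δ a e) _ _ ⟩
    δ a e + (u e + start)         ≡⟨ cong (δ a e +_) (rotor-conservation {x} valid T e) ⟩
    δ a e + (u e⁺ + now)          ≡⟨ solve 3 (λ p q r → p :+ (q :+ r) := q :+ (p :+ r)) refl (δ a e) (u e⁺) now ⟩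
    u e⁺ + (δ a e + now)          ≡⟨ cong (u e⁺ +_) (rotor-step {y} (run-valid {x} valid T) e) ⟩
    u e⁺ + (δ a e⁺ + after)       ≡⟨ solve 3 (λ p q r → q :+ (p :+ r) := p :+ q :+ r) refl (δ a e⁺) (u e⁺) after ⟩
    δ a e⁺ + u e⁺ + after         ∎
    where
    open ≡-Reasoning
    open +-*-Solver using (solve; _:=_; _:+_)
    y = run T x
    a = departing y
    u = uses x T
    e⁺ = next D e
    start = δ (rotor x (tail D e)) e
    now = δ (rotor y (tail D e)) e
    after = δ (rotor (op D y) (tail D e)) e

  -- Going round the cyclic order from the departing edge, `rotor-conservation` never lets the
  -- counts drop before the current rotor is reached, and its successor is the departing edge again.
  departing-least-used : ∀ {x} → Valid x → ∀ T e → tail D e ≡ chip (run T x) →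
    uses x T (departing (run T x)) ≤ uses x T e
  departing-least-used {x} valid T e at-chip
    with k , eq ← next-transitive (departing (run T x)) e
           (trans (tail-departing {run T x} (run-valid {x} valid T)) (sym at-chip))
    = subst (λ e → uses x T a ≤ uses x T e) eq (along k)
    where
    y = run T x
    a = departing y
    along : ∀ k → uses x T a ≤ uses x T (iter (next D) k a)
    along zero = ≤-refl
    along (suc k) with rotor y (chip y) ≟ iter (next D) k a
    ... | yes eq = ≤-reflexive (cong (uses x T ∘ next D) eq)
    ... | no ≢f = ≤-trans (along k) (≤-trans (m≤m+n _ _) (≤-reflexive (begin
      uses x T f + δ (rotor x (tail D f)) f            ≡⟨ rotor-conservation {x} valid T f ⟩
      uses x T (next D f) + δ (rotor y (tail D f)) f   ≡⟨ cong (uses x T (next D f) +_) (δ-≢ passed) ⟩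
      uses x T (next D f) + 0                          ≡⟨ +-identityʳ _ ⟩
      uses x T (next D f)                              ∎)))
      where
      open ≡-Reasoning
      f = iter (next D) k a
      passed : rotor y (tail D f) ≢ f
      passed = subst (λ v → rotor y v ≢ f) (sym (trans (tail-iter-next k a)
        (tail-departing {y} (run-valid {x} valid T)))) ≢f

  -- Dually, passing from any edge other than the initial rotor to its successor never raises the
  -- count, so the walk from `e` to the initial rotor only descends.
  initial-rotor-least-used : ∀ {x} → Valid x → ∀ T e → uses x T (rotor x (tail D e)) ≤ uses x T e
  initial-rotor-least-used {x} valid T e
    with k , eq ← next-transitive e (rotor x (tail D e)) (sym (valid _))
    = along k e refl eq
    where
    v = tail D e
    along : ∀ k e′ → tail D e′ ≡ v → iter (next D) k e′ ≡ rotor x v → uses x T (rotor x v) ≤ uses x T e′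
    along zero e′ _ refl = ≤-refl
    along (suc k) e′ at-v eq with rotor x v ≟ e′
    ... | yes refl = ≤-refl
    ... | no ≢e′ = ≤-trans
      (along k (next D e′) (trans (tail-next e′) at-v) (trans (sym (iter-shift (next D) k e′)) eq))
      (≤-trans (m≤m+n _ _) (≤-reflexive (begin
        uses x T (next D e′) + δ (rotor (run T x) (tail D e′)) e′ ≡⟨ rotor-conservation {x} valid T e′ ⟨
        uses x T e′ + δ (rotor x (tail D e′)) e′                  ≡⟨ cong (uses x T e′ +_) (δ-≢ passed) ⟩
        uses x T e′ + 0                                           ≡⟨ +-identityʳ _ ⟩
        uses x T e′                                               ∎)))
      where
      open ≡-Reasoning
      passed : rotor x (tail D e′) ≢ e′
      passed = subst (λ u → rotor x u ≢ e′) (sym at-v) ≢e′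

  -- In `rotor-conservation` at the initial rotor the equal counts cancel, and the final rotor
  -- inherits the `δ` of value 1.
  equal-uses⇒rotor-returns : ∀ {x} → Valid x → ∀ T v →
    (∀ e e′ → tail D e ≡ v → tail D e′ ≡ v → uses x T e ≡ uses x T e′) → rotor (run T x) v ≡ rotor x v
  equal-uses⇒rotor-returns {x} valid T v equal = 1≤δ⇒≡ (≤-reflexive (sym (+-cancelˡ-≡ (uses x T e) _ _ (begin
    uses x T e + δ (rotor (run T x) v) e
      ≡⟨ cong₂ (λ k u → k + δ (rotor (run T x) u) e)
           (equal e (next D e) (valid v) (trans (tail-next e) (valid v))) (sym (valid v)) ⟩
    uses x T (next D e) + δ (rotor (run T x) (tail D e)) e
      ≡⟨ rotor-conservation {x} valid T e ⟨
    uses x T e + δ (rotor x (tail D e)) e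
      ≡⟨ cong (λ u → uses x T e + δ (rotor x u) e) (valid v) ⟩
    uses x T e + δ e e
      ≡⟨ cong (uses x T e +_) (δ-refl e) ⟩
    uses x T e + 1 ∎))))
    where
    open ≡-Reasoning
    e = rotor x v

  -- Configurations whose rotors all lead to the chip.

  follow : Config D → Fin n → Fin n
  follow x v = head D (rotor x v)

  -- Equivalent to Unicycle, but visibly preserved by op.
  Rooted : Config D → Set
  Rooted x = Valid x × (∀ v → ∃ λ k → iter (follow x) k v ≡ chip x)

  -- A walk up to its first arrival at the old chip vertex meets only unchanged rotors; one more
  -- step along the new rotor there reaches the new chip vertex.
  op-rooted : ∀ {x} → Rooted x → Rooted (op D x)
  op-rooted {x} (valid , reach) = op-valid {x} valid , λ v → let k , eq = reach v in redirect k v eq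
    where
    redirect : ∀ k v → iter (follow x) k v ≡ chip x → ∃ λ k → iter (follow (op D x)) k v ≡ chip (op D x)
    redirect k v eq with v ≟ chip x
    redirect k v eq | yes refl = 1 , cong (head D) (rotor-op-chip x)
    redirect zero v eq | no v≢w = contradiction eq v≢w
    redirect (suc k) v eq | no v≢w
      with j , eq′ ← redirect k (follow x v) (trans (sym (iter-shift (follow x) k v)) eq)
      = suc j , trans (iter-shift (follow (op D x)) j v)
          (trans (cong (iter (follow (op D x)) j ∘ head D) (rotor-op-≢ x v≢w)) eq′)

  run-rooted : ∀ {x} → Rooted x → ∀ T → Rooted (run T x)
  run-rooted rooted zero = rooted
  run-rooted {x} rooted (suc T) = op-rooted {run T x} (run-rooted {x} rooted T)

  -- Every orbit has period the sum of the capacities.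

  module Period (sc : StronglyConnected D) (out : ∀ v → ∃ λ e → tail D e ≡ v)
                {per : Fin n → ℕ} (isPer : IsPer D per) where

    cap : Fin m → ℕ
    cap e = per (tail D e)

    period : ℕ
    period = sum cap

    per-balanced : Balanced D per
    per-balanced = kernel⇒balanced D per (proj₂ (proj₂ isPer))

    Within Stuck : Config D → ℕ → Set
    Within x T = ∀ e → uses x T e ≤ cap e
    Stuck x T = uses x T (departing (run T x)) ≡ cap (departing (run T x))

    within-until-stuck : ∀ x T → Within x T ⊎ (∃ λ S → Within x S × Stuck x S)
    within-until-stuck x zero = inj₁ λ _ → z≤n
    within-until-stuck x (suc T) with within-until-stuck x T
    ... | inj₂ stuck = inj₂ stuck
    ... | inj₁ within with m≤n⇒m<n∨m≡n (within (departing (run T x)))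
    ...   | inj₂ eq = inj₂ (T , within , eq)
    ...   | inj₁ used<cap = inj₁ within′
      where
      within′ : Within x (suc T)
      within′ e with departing (run T x) ≟ e
      ... | yes refl = used<cap
      ... | no _ = within e

    -- `T` steps make `T` uses in total, so `suc period` steps cannot all respect capacities summing
    -- to `period`.
    gets-stuck : ∀ x → ∃ λ S → Within x S × Stuck x S
    gets-stuck x with within-until-stuck x (suc period)
    ... | inj₂ stuck = stuck
    ... | inj₁ within = contradiction
      (≤-trans (≤-reflexive (sym (sum-uses x (suc period)))) (sum-mono within)) (n≮n period)

    Saturated : Config D → ℕ → Fin n → Set
    Saturated x T v = ∀ e → tail D e ≡ v → uses x T e ≡ cap e

    -- Balance of `per` converts the out-capacity into the in-capacity, which can be compared with
    -- arrivals.
    Out-saturated : ∀ {x T v} → Saturated x T v → Out D (uses x T) v ≡ In D cap v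
    Out-saturated {x} {T} {v} sat = trans (sum-cong-≗ at-v) (sym (per-balanced v))
      where
      at-v : ∀ e → δ (tail D e) v * uses x T e ≡ δ (tail D e) v * cap e
      at-v e with tail D e ≟ v
      ... | yes eq = cong (1 *_) (sat e eq)
      ... | no _ = refl

    full-period : ∀ {x} → Rooted x → (∀ e → uses x period e ≡ cap e) × run period x ≡ x
    full-period {x} (valid , reach) with S , within , stuck ← gets-stuck x
      -- All claims are proved at the blocking time `S`, which is identified with `period` last.
      = subst (λ T → (∀ e → uses x T e ≡ cap e) × run T x ≡ x) S≡period
          (saturated , cong₂ _,_ chip-back (lookup-injective rotors-back))
      where
      y = run S x
      -- The departing edge is full and is a least used edge at its vertex.
      sat-chip : Saturated x S (chip y)
      sat-chip e eq = ≤-antisym (within e) (begin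
        cap e                    ≡⟨ cong per (trans eq (sym (tail-departing {y} (run-valid {x} valid S)))) ⟩
        cap (departing y)        ≡⟨ stuck ⟨
        uses x S (departing y)   ≤⟨ departing-least-used {x} valid S e eq ⟩
        uses x S e               ∎)
        where open ≤-Reasoning
      In-within : ∀ v → In D (uses x S) v ≤ In D cap v
      In-within v = sum-mono (λ e → *-monoʳ-≤ (δ (head D e) v) (within e))
      -- The departures exhaust the in-capacity and the chip is here once more; arrivals alone
      -- cannot account for that, so the run began here.
      chip-back : chip y ≡ chip x
      chip-back = sym (1≤δ⇒≡ (+-cancelˡ-≤ (In D cap (chip y)) _ _ (begin
        In D cap (chip y) + 1                                  ≡⟨ cong₂ _+_ (Out-saturated {x} {S} sat-chip) (δ-refl (chip y)) ⟨
        Out D (uses x S) (chip y) + δ (chip y) (chip y)        ≡⟨ chip-conservation {x} valid S (chip y) ⟨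
        In D (uses x S) (chip y) + δ (chip x) (chip y)         ≤⟨ +-monoˡ-≤ _ (In-within (chip y)) ⟩
        In D cap (chip y) + δ (chip x) (chip y)                ∎)))
        where open ≤-Reasoning
      -- With the chip back at its start, arrivals equal departures at every vertex.
      In-saturated : ∀ {v} → Saturated x S v → ∀ e → head D e ≡ v → uses x S e ≡ cap e
      In-saturated {v} sat = In-mono-≡ D within (≤-reflexive (begin
        In D cap v          ≡⟨ Out-saturated {x} {S} sat ⟨
        Out D (uses x S) v  ≡⟨ +-cancelʳ-≡ (δ (chip x) v) _ _
                                (trans (chip-conservation {x} valid S v) (cong (λ w → Out D (uses x S) v + δ w v) chip-back)) ⟨
        In D (uses x S) v   ∎))
        where open ≡-Reasoning
      -- Induction on the rotor distance to the chip: the initial rotor of `v` enters a saturated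
      -- vertex, so it is full, and it is a least used edge at `v`.
      sat : ∀ k v → iter (follow x) k v ≡ chip x → Saturated x S v
      sat zero v refl = subst (Saturated x S) chip-back sat-chip
      sat (suc k) v eq e refl = ≤-antisym (within e) (begin
        cap e                        ≡⟨ cong per (valid (tail D e)) ⟨
        cap (rotor x v)              ≡⟨ In-saturated (sat k (follow x v) toward-chip) (rotor x v) refl ⟨
        uses x S (rotor x v)         ≤⟨ initial-rotor-least-used {x} valid S e ⟩
        uses x S e                   ∎)
        where
        open ≤-Reasoning
        toward-chip : iter (follow x) k (follow x v) ≡ chip x
        toward-chip = trans (sym (iter-shift (follow x) k v)) eq
      saturated : ∀ e → uses x S e ≡ cap e
      saturated e = let k , eq = reach (tail D e) in sat k (tail D e) eq e refl
      rotors-back : ∀ v → rotor y v ≡ rotor x v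
      rotors-back v = equal-uses⇒rotor-returns {x} valid S v λ e e′ eq eq′ →
        trans (saturated e) (trans (cong per (trans eq (sym eq′))) (sym (saturated e′)))
      S≡period : S ≡ period
      S≡period = trans (sym (sum-uses x S)) (sum-cong-≗ saturated)

    -- A return cancels the endpoint terms of both conservation laws: all edges at a vertex are used
    -- equally often, and the common counts `turns` form a balanced vector, to which `per-minimal`
    -- applies.
    return⇒cap≤uses : ∀ {x} → Valid x → ∀ p → run (suc p) x ≡ x → ∀ e → cap e ≤ uses x (suc p) e
    return⇒cap≤uses {x} valid p return e =
      ≤-trans (per-minimal D sc {c = turns} isPer balanced (tail D a) turns>0 (tail D e)) (≤-reflexive (turns-tail e))
      where
      u = uses x (suc p)
      a = departing (run p x)
      u-next : ∀ e → u (next D e) ≡ u e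
      u-next e = sym (+-cancelʳ-≡ (δ (rotor x (tail D e)) e) _ _
        (trans (rotor-conservation {x} valid (suc p) e) (cong (λ y → u (next D e) + δ (rotor y (tail D e)) e) return)))
      u-iter : ∀ k e → u (iter (next D) k e) ≡ u e
      u-iter zero e = refl
      u-iter (suc k) e = trans (u-next _) (u-iter k e)
      turns : Fin n → ℕ
      turns v = u (proj₁ (out v))
      turns-tail : ∀ e → turns (tail D e) ≡ u e
      turns-tail e = let e₀ , at-v = out (tail D e) ; k , eq = next-transitive e₀ e at-v in
        trans (sym (u-iter k e₀)) (cong u eq)
      balanced : Balanced D turns
      balanced i = begin
        In D (turns ∘ tail D) i  ≡⟨ sum-cong-≗ (λ e → cong (δ (head D e) i *_) (turns-tail e)) ⟩
        In D u i                 ≡⟨ +-cancelʳ-≡ (δ (chip x) i) _ _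
                                     (trans (chip-conservation {x} valid (suc p) i) (cong (λ y → Out D u i + δ (chip y) i) return)) ⟩
        Out D u i                ≡⟨ sum-cong-≗ (λ e → cong (δ (tail D e) i *_) (turns-tail e)) ⟨
        Out D (turns ∘ tail D) i ∎
        where open ≡-Reasoning
      -- The edge `a` of the last step is used at least once.
      turns>0 : 0 < turns (tail D a)
      turns>0 = begin-strict
        0                      <⟨ s≤s z≤n ⟩
        1                      ≡⟨ δ-refl a ⟨
        δ a a                  ≤⟨ m≤m+n _ _ ⟩
        u a                    ≡⟨ turns-tail a ⟨
        turns (tail D a)       ∎
        where open ≤-Reasoning

    -- A return between times `i` and `j` already uses every edge to capacity, yet the edge
    -- departing at time `j` is used once more within the period.
    no-early-return : ∀ {x} → Rooted x → ∀ {i j} → i < j → j < period → run i x ≢ run j x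
    no-early-return {x} rooted@(valid , _) {i} {j} i<j j<period same = n≮n (cap a) (begin-strict
      cap a                                 ≤⟨ return⇒cap≤uses {run i x} (run-valid {x} valid i) p return a ⟩
      uses (run i x) (suc p) a              ≤⟨ m≤m+n _ _ ⟩
      uses (run i x) (suc p) a + uses x i a ≡⟨ uses-+ x (suc p) i a ⟨
      uses x (suc p + i) a                  ≡⟨ cong (λ k → uses x k a) split ⟩
      uses x j a                            <⟨ ≤-refl ⟩
      1 + uses x j a                        ≡⟨ cong (_+ uses x j a) (δ-refl a) ⟨
      uses x (suc j) a                      ≤⟨ uses-mono x j<period a ⟩
      uses x period a                       ≡⟨ proj₁ (full-period rooted) a ⟩
      cap a                                 ∎)
      where
      open ≤-Reasoning
      a = departing (run j x)
      p = j ∸ suc i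
      split : suc p + i ≡ j
      split = trans (sym (+-suc p i)) (m∸n+n≡m i<j)
      return : run (suc p) (run i x) ≡ run i x
      return = trans (sym (iter-+ (op D) (suc p) i x)) (trans (cong (λ k → run k x) split) (sym same))

  -- Unicycles are the rooted configurations.

  -- The cycle is the forward orbit of `y`; bounding the exponent by the period makes membership
  -- decidable.
  cycle-through : ∀ x y p → iter (follow x) (suc p) y ≡ y →
    ∃ λ C → IsCycle D (proj₂ x) C × (∀ v → v ∈ C ⇔ (∃ λ k → iter (follow x) k y ≡ v))
  cycle-through x y p return = C , ((y , to (0 , refl)) , closed , connected) , λ v → mk⇔ from to
    where
    g = follow x
    hit? : ∀ v → Dec (∃ λ k → k < suc p × iter g k y ≡ v)
    hit? v = anyUpTo? (λ k → iter g k y ≟ v) (suc p)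
    C = subset hit?
    to : ∀ {v} → (∃ λ k → iter g k y ≡ v) → v ∈ C
    to (k , refl) = ∈-subset⁺ hit? (iter-mod g (s≤s z≤n) return k)
    from : ∀ {v} → v ∈ C → ∃ λ k → iter g k y ≡ v
    from v∈C = let k , _ , eq = ∈-subset⁻ hit? v∈C in k , eq
    closed : ∀ v → v ∈ C → g v ∈ C
    closed v v∈C = let k , eq = from v∈C in to (suc k , cong g eq)
    connected : ∀ u v → u ∈ C → v ∈ C → ∃ λ k → iter g k u ≡ v
    connected u v u∈C v∈C with a , a<1+p , refl ← ∈-subset⁻ hit? u∈C | b , refl ← from v∈C
      = b + (suc p ∸ a) , (begin
        iter g (b + (suc p ∸ a)) (iter g a y)        ≡⟨ iter-+ g b (suc p ∸ a) _ ⟩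
        iter g b (iter g (suc p ∸ a) (iter g a y))   ≡⟨ cong (iter g b) (iter-+ g (suc p ∸ a) a y) ⟨
        iter g b (iter g (suc p ∸ a + a) y)          ≡⟨ cong (λ l → iter g b (iter g l y)) (m∸n+n≡m (<⇒≤ a<1+p)) ⟩
        iter g b (iter g (suc p) y)                  ≡⟨ cong (iter g b) return ⟩
        iter g b y                                   ∎)
      where open ≡-Reasoning

  -- Following the rotors from any vertex ends in a cycle, which by uniqueness is the one carrying
  -- the chip.
  unicycle⇒rooted : ∀ {x} → Unicycle D x → Rooted x
  unicycle⇒rooted {x} (valid , C , _ , w∈C , unique) = valid , reach
    where
    reach : ∀ v → ∃ λ k → iter (follow x) k v ≡ chip x
    reach v
      with i , p , return ← eventually-periodic (follow x) v
      with C′ , cycle , member ← cycle-through x (iter (follow x) i v) p return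
      with k , eq ← Equivalence.to (member (chip x)) (subst (chip x ∈_) (sym (unique C′ cycle)) w∈C)
      = k + i , trans (iter-+ (follow x) k i v) eq

  -- The chip vertex lies on its own cycle. Any other cycle is closed under `follow`, hence contains
  -- the chip vertex and equals its orbit.
  rooted⇒unicycle : ∀ {x} → Rooted x → Unicycle D x
  rooted⇒unicycle {x} (valid , reach)
    with k , return ← reach (follow x (chip x))
    with C , cycle , member ← cycle-through x (chip x) k (trans (iter-shift (follow x) k (chip x)) return)
    = valid , C , cycle , Equivalence.from (member (chip x)) (0 , refl) , unique
    where
    unique : ∀ C′ → IsCycle D (proj₂ x) C′ → C′ ≡ C
    unique C′ ((u , u∈C′) , closed , connected) = ⊆-antisym
      (λ {v} v∈C′ → Equivalence.from (member v) (connected (chip x) v w∈C′ v∈C′))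
      (λ {v} v∈C → let j , eq = Equivalence.to (member v) v∈C in subst (_∈ C′) eq (iter-closed j (chip x) w∈C′))
      where
      iter-closed : ∀ j v → v ∈ C′ → iter (follow x) j v ∈ C′
      iter-closed zero v v∈C′ = v∈C′
      iter-closed (suc j) v v∈C′ = closed _ (iter-closed j v v∈C′)
      w∈C′ : chip x ∈ C′
      w∈C′ = let j , eq = reach u in subst (_∈ C′) eq (iter-closed j u u∈C′)

  -- Unicycles about to use `e₁` correspond to arborescences rooted at `w`.

  module Arborescence (w : Fin n) (e₁ : Fin m) (tail-e₁ : tail D e₁ ≡ w) where

    -- The walk from `next D e₁` round to `e₁`, started one edge earlier, ends at the predecessor of
    -- `e₁`.
    pred-e₁ : ∃ λ e → tail D e ≡ w × next D e ≡ e₁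
    pred-e₁ with k , eq ← next-transitive (next D e₁) e₁ (tail-next e₁)
      = iter (next D) k e₁ , trans (tail-iter-next k e₁) tail-e₁ , trans (iter-shift (next D) k e₁) eq

    Marked : Config D → Set
    Marked x = Rooted x × departing x ≡ e₁

    marked-chip : ∀ {x} → Marked x → chip x ≡ w
    marked-chip {x} ((valid , _) , eq) = trans (sym (tail-departing {x} valid)) (trans (cong (tail D) eq) tail-e₁)

    tree-edge? : ∀ x e → Dec (tail D e ≢ w × rotor x (tail D e) ≡ e)
    tree-edge? x e = ¬? (tail D e ≟ w) ×-dec (rotor x (tail D e) ≟ e)

    tree : Config D → Subset m
    tree x = subset (tree-edge? x)

    rotor∈tree : ∀ x {v} → Valid x → v ≢ w → rotor x v ∈ tree x
    rotor∈tree x {v} valid v≢w =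
      ∈-subset⁺ (tree-edge? x) ((λ eq → v≢w (trans (sym (valid v)) eq)) , cong (rotor x) (valid v))

    -- Away from `w` the rotor is the tree edge; at `w` it is fixed by the mark, since `next D` is
    -- injective.
    tree-injective : ∀ {x y} → Marked x → Marked y → tree x ≡ tree y → x ≡ y
    tree-injective {x} {y} mx@((vx , _) , dx) my@((vy , _) , dy) eq =
      cong₂ _,_ (trans (marked-chip {x} mx) (sym (marked-chip {y} my))) (lookup-injective same-rotor)
      where
      same-rotor : ∀ v → rotor x v ≡ rotor y v
      same-rotor v with v ≟ w
      ... | yes refl = next-injective (begin
        next D (rotor x v)     ≡⟨ cong (next D ∘ rotor x) (marked-chip {x} mx) ⟨
        departing x            ≡⟨ trans dx (sym dy) ⟩
        departing y            ≡⟨ cong (next D ∘ rotor y) (marked-chip {y} my) ⟩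
        next D (rotor y v)     ∎)
        where open ≡-Reasoning
      ... | no v≢w = sym (trans (cong (rotor y) (sym (vx v)))
        (proj₂ (∈-subset⁻ (tree-edge? y) (subst (rotor x v ∈_) eq (rotor∈tree x vx v≢w)))))

    tree-arborescence : ∀ {x} → Marked x → IsArb D w (tree x)
    tree-arborescence {x} marked@((valid , reach) , _) =
      parent , (λ e e∈ → proj₁ (in-tree e∈)) ,
      λ (e , e∈ , path) → let k , eq = reach (tail D e) in acyclic k e e∈ path (trans eq (marked-chip {x} marked))
      where
      in-tree : ∀ {e} → e ∈ tree x → tail D e ≢ w × rotor x (tail D e) ≡ e
      in-tree = ∈-subset⁻ (tree-edge? x)
      parent : ∀ v → v ≢ w → HasCard (λ e → e ∈ tree x × tail D e ≡ v) 1
      parent v v≢w = rotor x v ∷ [] , refl , [] ∷ [] , λ e → mk⇔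
        (λ { (e∈ , refl) → here (sym (proj₂ (in-tree e∈))) })
        (λ { (here refl) → rotor∈tree x valid v≢w , valid v })
      -- A closed path through e can be rotated along the rotors until it passes through w.
      acyclic : ∀ k e → e ∈ tree x → Path D (_∈ tree x) (head D e) (tail D e) → iter (follow x) k (tail D e) ≢ w
      acyclic zero e e∈ path = proj₁ (in-tree e∈)
      acyclic (suc k) e e∈ path eq = rotate path refl
        where
        snoc : ∀ {u} → Path D (_∈ tree x) u (tail D e) → Path D (_∈ tree x) u (head D e)
        snoc = go refl
          where
          go : ∀ {u v} → v ≡ tail D e → Path D (_∈ tree x) u v → Path D (_∈ tree x) u (head D e)
          go refl here = step e e∈ refl here
          go eq (step f f∈ at-u rest) = step f f∈ at-u (go eq rest)
        eq′ : iter (follow x) k (head D e) ≡ w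
        eq′ = trans (cong (iter (follow x) k ∘ head D) (sym (proj₂ (in-tree e∈))))
          (trans (sym (iter-shift (follow x) k (tail D e))) eq)
        rotate : ∀ {v} → Path D (_∈ tree x) (head D e) v → v ≡ tail D e → ⊥
        -- If `e` is a loop, the same edge serves with one rotor step fewer.
        rotate here loop = acyclic k e e∈ path (trans (cong (iter (follow x) k) (sym loop)) eq′)
        rotate (step f f∈ at rest) refl =
          acyclic k f f∈ (subst (Path D (_∈ tree x) (head D f)) (sym at) (snoc rest))
            (trans (cong (iter (follow x) k) at) eq′)

    -- The rotors are the tree edges away from `w` and the predecessor of `e₁` at `w`; acyclicity
    -- forces every rotor walk to reach `w`.
    arborescence-tree : ∀ {S} → IsArb D w S → ∃ λ x → Marked x × tree x ≡ S
    arborescence-tree {S} (card , avoids-w , acyclic) = x , ((valid , reach) , departs) , ⊆-antisym tree⊆S S⊆tree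
      where
      parent : ∀ v → v ≢ w → ∃ λ e → e ∈ S × tail D e ≡ v × (∀ f → f ∈ S → tail D f ≡ v → f ≡ e)
      parent v v≢w with card v v≢w
      ... | e ∷ [] , _ , _ , iff
        with e∈S , at-v ← Equivalence.from (iff e) (here refl)
        = e , e∈S , at-v , λ f f∈S at-v → only (Equivalence.to (iff f) (f∈S , at-v))
        where
        only : ∀ {f} → f LM.∈ (e ∷ []) → f ≡ e
        only (here eq) = eq
      choose : Fin n → Fin m
      choose v with v ≟ w
      ... | yes _ = proj₁ pred-e₁
      ... | no v≢w = proj₁ (parent v v≢w)
      x : Config D
      x = w , tabulate choose
      rotor-choose : ∀ v → rotor x v ≡ choose v
      rotor-choose = lookup∘tabulate choose
      rotor-w : rotor x w ≡ proj₁ pred-e₁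
      rotor-w with w ≟ w | rotor-choose w
      ... | yes _ | eq = eq
      ... | no w≢w | _ = contradiction refl w≢w
      rotor-parent : ∀ v → v ≢ w → rotor x v ∈ S × tail D (rotor x v) ≡ v ×
        (∀ f → f ∈ S → tail D f ≡ v → f ≡ rotor x v)
      rotor-parent v v≢w with v ≟ w | rotor-choose v
      ... | yes v≡w | _ = contradiction v≡w v≢w
      ... | no v≢w | eq = subst (λ e → e ∈ S × tail D e ≡ v × (∀ f → f ∈ S → tail D f ≡ v → f ≡ e))
        (sym eq) (proj₂ (parent v v≢w))
      departs : departing x ≡ e₁
      departs = trans (cong (next D) rotor-w) (proj₂ (proj₂ pred-e₁))
      valid : Valid x
      valid v with v ≟ w
      ... | yes refl = trans (cong (tail D) rotor-w) (proj₁ (proj₂ pred-e₁))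
      ... | no v≢w = proj₁ (proj₂ (rotor-parent v v≢w))
      path : ∀ k u → (∀ j → j < k → iter (follow x) j u ≢ w) → Path D (_∈ S) u (iter (follow x) k u)
      path zero u avoid = here
      path (suc k) u avoid =
        step (rotor x u) (proj₁ (rotor-parent u (avoid 0 (s≤s z≤n)))) (valid u)
          (subst (Path D (_∈ S) (follow x u)) (sym (iter-shift (follow x) k u))
            (path k (follow x u) λ j j<k eq → avoid (suc j) (s≤s j<k) (trans (iter-shift (follow x) j u) eq)))
      reach : ∀ v → ∃ λ k → iter (follow x) k v ≡ w
      reach v with i , p , return ← eventually-periodic (follow x) v
        with anyUpTo? (λ k → iter (follow x) k (iter (follow x) i v) ≟ w) (suc p)
      ... | yes (k , _ , eq) = k + i , trans (iter-+ (follow x) k i v) eq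
      -- A periodic rotor walk missing `w` would close up to a directed cycle inside `S`.
      ... | no avoid = contradiction
        (rotor x y , proj₁ (rotor-parent y (λ eq → avoid (0 , s≤s z≤n , eq))) ,
          subst (Path D (_∈ S) (follow x y)) (trans (sym (iter-shift (follow x) p y)) (trans return (sym (valid y))))
            (path p (follow x y) λ j j<p eq → avoid (suc j , s≤s j<p , trans (iter-shift (follow x) j y) eq)))
        acyclic
        where y = iter (follow x) i v
      tree⊆S : tree x ⊆ S
      tree⊆S {e} e∈ = let e≢w , eq = ∈-subset⁻ (tree-edge? x) e∈ in
        subst (_∈ S) eq (proj₁ (rotor-parent (tail D e) e≢w))
      S⊆tree : S ⊆ tree x
      S⊆tree {e} e∈S = ∈-subset⁺ (tree-edge? x) (avoids-w e e∈S ,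
        sym (proj₂ (proj₂ (rotor-parent (tail D e) (avoids-w e e∈S))) e e∈S refl))

  -- Counting the marked unicycles orbit by orbit.

  module Count (sc : StronglyConnected D) (out : ∀ v → ∃ λ e → tail D e ≡ v)
               {per : Fin n → ℕ} (isPer : IsPer D per) (w : Fin n) where

    open Period sc out isPer

    e₁ : Fin m
    e₁ = proj₁ (out w)

    open Arborescence w e₁ (proj₂ (out w))

    period>0 : 0 < period
    period>0 = ≤-trans (proj₁ isPer _) (term≤sum cap e₁)

    marked? : ∀ x → Dec (departing x ≡ e₁)
    marked? x = departing x ≟ e₁

    -- For rooted `x`, one period runs through the orbit exactly once, so these are all its marked
    -- configurations.
    visits : Config D → List (Config D)
    visits x = filter marked? (applyDownFrom (λ i → run i x) period)

    -- `applyDownFrom` lists the latest time first, matching the recursion of `uses`.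
    length-filter-marked : ∀ x T → length (filter marked? (applyDownFrom (λ i → run i x) T)) ≡ uses x T e₁
    length-filter-marked x zero = refl
    length-filter-marked x (suc T) with departing (run T x) ≟ e₁
    ... | yes _ = cong suc (length-filter-marked x T)
    ... | no _ = length-filter-marked x T

    length-visits : ∀ {x} → Rooted x → length (visits x) ≡ per w
    length-visits {x} rooted = trans (length-filter-marked x period)
      (trans (proj₁ (full-period {x} rooted) e₁) (cong per (proj₂ (out w))))

    unique-visits : ∀ {x} → Rooted x → Unique (visits x)
    unique-visits {x} rooted = Unique.filter⁺ marked? (Unique.applyDownFrom⁺₁ (λ i → run i x) period
      (λ j<i i<N eq → no-early-return {x} rooted j<i i<N (sym eq)))

    visits⁻ : ∀ {x z} → z LM.∈ visits x → (∃ λ i → i < period × z ≡ run i x) × departing z ≡ e₁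
    visits⁻ {x} z∈ = let z∈′ , marked = LMP.∈-filter⁻ marked? z∈ in
      LMP.∈-applyDownFrom⁻ (λ i → run i x) z∈′ , marked

    -- `SameOrbit` only looks forward: from a shared configuration, completing the period of `y`
    -- leads back to `y`, so `x` reaches `y`.
    disjoint-visits : ∀ {x y} → Rooted y → ¬ SameOrbit D x y → Disjoint (visits x) (visits y)
    disjoint-visits {x} {y} rooted different (z∈x , z∈y)
      with (i , _ , refl) , _ ← visits⁻ {x} z∈x | (j , j<N , eq) , _ ← visits⁻ {y} z∈y
      = different (period ∸ j + i , (begin
        run (period ∸ j + i) x         ≡⟨ iter-+ (op D) (period ∸ j) i x ⟩
        run (period ∸ j) (run i x)     ≡⟨ cong (run (period ∸ j)) eq ⟩
        run (period ∸ j) (run j y)     ≡⟨ iter-+ (op D) (period ∸ j) j y ⟨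
        run (period ∸ j + j) y         ≡⟨ cong (λ k → run k y) (m∸n+n≡m (<⇒≤ j<N)) ⟩
        run period y                   ≡⟨ proj₂ (full-period {y} rooted) ⟩
        y                              ∎))
      where open ≡-Reasoning

    all-visits : List (Config D) → List (Config D)
    all-visits = concatMap visits

    length-all-visits : ∀ {reps} → All Rooted reps → length (all-visits reps) ≡ length reps * per w
    length-all-visits [] = refl
    length-all-visits (_∷_ {x} {xs} rooted rest) = trans (length-++ (visits x))
      (cong₂ _+_ (length-visits {x} rooted) (length-all-visits rest))

    unique-all-visits : ∀ {reps} → All Rooted reps → AllPairs (λ x y → ¬ SameOrbit D x y) reps →
                        Unique (all-visits reps)
    unique-all-visits rooted different = Unique.concat⁺
      (All.map⁺ (All.map (λ {x} → unique-visits {x}) rooted)) (disjoint rooted different)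
      where
      disjoint : ∀ {reps} → All Rooted reps → AllPairs (λ x y → ¬ SameOrbit D x y) reps →
                 AllPairs Disjoint (map visits reps)
      disjoint [] [] = []
      disjoint (_∷_ {x} _ rooted) (here-different ∷ different) =
        disjoint-head rooted here-different ∷ disjoint rooted different
        where
        disjoint-head : ∀ {ys} → All Rooted ys → All (λ y → ¬ SameOrbit D x y) ys →
                        All (Disjoint (visits x)) (map visits ys)
        disjoint-head [] [] = []
        disjoint-head (_∷_ {y} r rs) (d ∷ ds) = (λ {z} → disjoint-visits {x} {y} r d {z}) ∷ disjoint-head rs ds

    all-visits⁻ : ∀ {reps z} → All Rooted reps → z LM.∈ all-visits reps → Marked z
    all-visits⁻ {reps} rooted z∈
      with r , r∈ , z∈r ← find (LMP.∈-concatMap⁻ visits {xs = reps} z∈)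
      with (i , _ , refl) , marked ← visits⁻ {r} z∈r
      = run-rooted {r} (All.lookup rooted r∈) i , marked

    all-visits⁺ : ∀ {reps z} → All Rooted reps → Any (λ r → SameOrbit D r z) reps → departing z ≡ e₁ →
                  z LM.∈ all-visits reps
    all-visits⁺ {reps} {z} rooted covered marked
      with r , r∈ , k , refl ← find covered
      -- The time `k` is arbitrary, while `visits` lists times below `period` only.
      with i , i<N , eq ← iter-mod (op D) period>0 (proj₂ (full-period {r} (All.lookup rooted r∈))) k
      = LMP.∈-concatMap⁺ visits (lose r∈
        (LMP.∈-filter⁺ marked? (subst (LM._∈ applyDownFrom (λ i → run i r) period) eq
          (LMP.∈-applyDownFrom⁺ (λ i → run i r) i<N)) marked))

    -- Double counting: the marked unicycles number `per w` in each orbit, and `tree` maps them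
    -- bijectively onto the arborescences.
    orbits*per≡trees : ∀ k t → NumOrbits D k → HasCard (IsArb D w) t → k * per w ≡ t
    orbits*per≡trees k t (reps , length-reps , unicycles , different , cover)
                     (trees , length-trees , unique-trees , trees-iff) = begin
      k * per w                            ≡⟨ cong (_* per w) length-reps ⟨
      length reps * per w                  ≡⟨ length-all-visits rooted ⟨
      length (all-visits reps)             ≡⟨ length-map tree (all-visits reps) ⟨
      length (map tree (all-visits reps))  ≡⟨ unique-length unique-images unique-trees (mk⇔ to from) ⟩
      length trees                         ≡⟨ length-trees ⟩
      t                                    ∎
      where
      open ≡-Reasoning
      rooted : All Rooted reps
      rooted = All.map (λ {x} → unicycle⇒rooted {x}) unicycles
      unique-images : Unique (map tree (all-visits reps))
      unique-images = map-unique tree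
        (λ x∈ y∈ → tree-injective (all-visits⁻ rooted x∈) (all-visits⁻ rooted y∈))
        (unique-all-visits rooted different)
      to : ∀ {S} → S LM.∈ map tree (all-visits reps) → S LM.∈ trees
      to S∈ with x , x∈ , refl ← LMP.∈-map⁻ tree S∈ =
        Equivalence.to (trees-iff _) (tree-arborescence {x} (all-visits⁻ rooted x∈))
      from : ∀ {S} → S LM.∈ trees → S LM.∈ map tree (all-visits reps)
      from S∈ with x , (x-rooted , marked) , refl ← arborescence-tree (Equivalence.from (trees-iff _) S∈) =
        LMP.∈-map⁺ tree (all-visits⁺ rooted (cover x (rooted⇒unicycle {x} x-rooted)) marked)

theorem3 : ∀ {n m} (D : RotorGraph n m) → IsCyclicOrder D
    → (∀ v → ∃ λ e → tail D e ≡ v) → StronglyConnected D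
    → (per : Fin n → ℕ) → IsPer D per
    → (w : Fin n) (k t : ℕ) → NumOrbits D k → HasCard (IsArb D w) t
    → k * per w ≡ t
theorem3 D cyclic out sc per isPer w = orbits*per≡trees
  where
  open Rotor D cyclic
  open Count sc out isPer w
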